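{- Let $q$ be a prime power, let $d$ be a positive integer, and let $k \in \{1,2,\ldots,d-1\}$. Let $E \subset \mathbb{F}_q^d$ be a set with $30q^k \leq |E| \leq q^{k+1}$, and let $M$ be an integer with $|E|q^{ -1} \leq M \leq 4^{ -1}q^k$. Then $$\#\{y \in \mathbb{F}_q^d : |\pi^y(E)| \leq M\} < 300\,q^k M |E|^{ -1}.$$
   Context: $\mathbb{F}_q$ denotes the finite field with $q$ elements and $\mathbb{F}_q^d$ the $d$-dimensional vector space over it. A line is an affine line (a translate of a $1$-dimensional linear subspace of $\mathbb{F}_q^d$). For a point $y \in \mathbb{F}_q^d$, the radial projection $\pi^y$ maps each point $x \in \mathbb{F}_q^d \setminus \{y\}$ to the unique line containing $x$ and $y$. For a set $E \subset \mathbb{F}_q^d$, $\pi^y(E)$ denotes the set of lines $\{\pi^y(x) : x \in E \setminus \{y\}\}$, and $|\pi^y(E)|$ is the number of distinct lines in this set (i.e. the number of lines through $y$ that contain at least one point of $E$ other than $y$). -}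

module Defs where

open import Level using (Level; _⊔_) renaming (suc to lsuc)
open import Algebra.Core using (Op₁; Op₂)
open import Algebra.Apartness.Structures using (IsHeytingField)
open import Algebra.Bundles using (CommutativeRing)
import Algebra.Properties.Ring as RingProperties
open import Data.Fin.Base using (Fin)
import Data.Fin.Properties as Fin
open import Data.List.Base using (List; []; _∷_; map; allFin; filter; mapMaybe; deduplicate; length; cartesianProductWith)
open import Data.List.Membership.Propositional using (_∈_)
open import Data.List.Membership.Propositional.Properties using (∈-map⁺; ∈-allFin; ∈-cartesianProductWith⁺)
import Data.List.Relation.Unary.All as All
import Data.List.Relation.Unary.Any as Any
import Data.List.Relation.Unary.AllPairs as AllPairs
open import Data.List.Relation.Unary.Unique.Propositional using (Unique)
import Data.List.Relation.Unary.Unique.Propositional.Properties as Unique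
open import Data.Maybe.Base using (Maybe; just; nothing)
open import Data.Nat.Base using (ℕ; zero; suc; _^_; _≤_)
open import Data.Nat.Primality using (Prime)
open import Data.Product.Base using (∃; ∃₂; _×_; _,_; proj₁; proj₂)
open import Data.Vec.Base using (Vec; []; _∷_; replicate; zipWith)
import Data.Vec.Base as Vec
open import Data.Vec.Properties using (≡-dec; ∷-injective)
open import Function.Base using (_∘_)
open import Function.Bundles using (_↔_; _⇔_; Injection; Inverse; Equivalence; mk⇔)
open import Function.Properties.Inverse using (↔⇒↣; ↔-sym)
open import Relation.Binary.Definitions using (DecidableEquality)
import Relation.Binary.Definitions as B
open import Relation.Binary.PropositionalEquality using (_≡_; _≢_; refl; sym; trans; cong; cong₂; subst; module ≡-Reasoning)
open import Relation.Nullary using (Dec; yes; no; map′; _×-dec_; _→-dec_)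
open import Relation.Unary using (Pred; Decidable)

IsPrimePower : ℕ → Set
IsPrimePower q = ∃₂ λ p e → Prime p × 1 ≤ e × q ≡ p ^ e

-- A field with exactly q elements.  With apartness taken to be _≢_, a Heyting
-- field is an ordinary field: x - y is invertible if and only if x ≢ y, which
-- gives inverses of non-zero elements and also 0# ≢ 1#.  Equality is
-- propositional because every finite set is in bijection with some Fin q.
record FiniteField (c : Level) (q : ℕ) : Set (lsuc c) where
  infixl 7 _*_
  infixl 6 _+_
  infix  8 -_
  field
    Carrier        : Set c
    _+_ _*_        : Op₂ Carrier
    -_             : Op₁ Carrier
    0# 1#          : Carrier
    isHeytingField : IsHeytingField _≡_ _≢_ _+_ _*_ -_ 0# 1#
    enumeration    : Carrier ↔ Fin q

  open IsHeytingField isHeytingField public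
    using (isCommutativeRing; #⇒invertible; invertible⇒#)

  commutativeRing : CommutativeRing c c
  commutativeRing = record { isCommutativeRing = isCommutativeRing }

  infix 4 _≟_
  _≟_ : DecidableEquality Carrier
  _≟_ = Fin.inj⇒≟ (↔⇒↣ enumeration)

  elements : List Carrier
  elements = map (Inverse.from enumeration) (allFin q)

  ∈-elements : ∀ x → x ∈ elements
  ∈-elements x = subst (_∈ elements) (Inverse.strictlyInverseʳ enumeration x)
    (∈-map⁺ (Inverse.from enumeration) (∈-allFin (Inverse.to enumeration x)))

  elements-unique : Unique elements
  elements-unique = Unique.map⁺ (Injection.injective (↔⇒↣ (↔-sym enumeration))) (Unique.allFin⁺ q)

module Affine {c : Level} {q : ℕ} (F : FiniteField c q) where

  open FiniteField F

  Point : ℕ → Set c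
  Point d = Vec Carrier d

  infixl 6 _+ᵛ_ _-ᵛ_
  infixl 7 _*ᵛ_

  0ᵛ : ∀ {d} → Point d
  0ᵛ = replicate _ 0#

  _+ᵛ_ _-ᵛ_ : ∀ {d} → Point d → Point d → Point d
  _+ᵛ_ = zipWith _+_
  _-ᵛ_ = zipWith (λ a b → a + - b)

  _*ᵛ_ : ∀ {d} → Carrier → Point d → Point d
  t *ᵛ v = Vec.map (t *_) v

  infix 4 _≟ᵛ_
  _≟ᵛ_ : ∀ {d} → DecidableEquality (Point d)
  _≟ᵛ_ = ≡-dec _≟_

  points : ∀ d → List (Point d)
  points zero    = [] ∷ []
  points (suc d) = cartesianProductWith _∷_ elements (points d)

  ∈-points : ∀ {d} (x : Point d) → x ∈ points d
  ∈-points []      = Any.here refl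
  ∈-points (a ∷ x) = ∈-cartesianProductWith⁺ _∷_ (∈-elements a) (∈-points x)

  points-unique : ∀ d → Unique (points d)
  points-unique zero    = All.[] AllPairs.∷ AllPairs.[]
  points-unique (suc d) = Unique.cartesianProductWith⁺ _∷_ ∷-injective elements-unique (points-unique d)

  card : ∀ {ℓ d} {E : Pred (Point d) ℓ} → Decidable E → ℕ
  card {d = d} E? = length (filter E? (points d))

  -- The affine line base + span(direction).  Different base points and
  -- directions may present the same line, so lines are compared by _≈ᴸ_.
  record Line (d : ℕ) : Set c where
    constructor line
    field
      base          : Point d
      direction     : Point d
      direction≢0ᵛ  : direction ≢ 0ᵛ

  infix 4 _∈ᴸ_ _∈ᴸ?_ _≈ᴸ_ _≈ᴸ?_

  _∈ᴸ_ : ∀ {d} → Point d → Line d → Set c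
  p ∈ᴸ ℓ = ∃ λ t → p ≡ Line.base ℓ +ᵛ t *ᵛ Line.direction ℓ

  _≈ᴸ_ : ∀ {d} → Line d → Line d → Set c
  ℓ ≈ᴸ m = ∀ p → p ∈ᴸ ℓ ⇔ p ∈ᴸ m

  _∈ᴸ?_ : ∀ {d} (p : Point d) (ℓ : Line d) → Dec (p ∈ᴸ ℓ)
  p ∈ᴸ? ℓ = map′ Any.satisfied (λ (t , eq) → Any.map (λ { refl → eq }) (∈-elements t))
    (Any.any? (λ t → p ≟ᵛ Line.base ℓ +ᵛ t *ᵛ Line.direction ℓ) elements)

  _≈ᴸ?_ : ∀ {d} → B.Decidable (_≈ᴸ_ {d})
  _≈ᴸ?_ {d} ℓ m = map′ (λ all p → All.lookup all (∈-points p)) (λ ℓ≈m → All.tabulate (λ {p} _ → ℓ≈m p))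
    (All.all? (λ p → ⇔-dec (p ∈ᴸ? ℓ) (p ∈ᴸ? m)) (points d))
    where
    ⇔-dec : ∀ {a} {A B : Set a} → Dec A → Dec B → Dec (A ⇔ B)
    ⇔-dec A? B? = map′ (λ (f , g) → mk⇔ f g) (λ e → Equivalence.to e , Equivalence.from e)
      ((A? →-dec B?) ×-dec (B? →-dec A?))

  private
    module R = CommutativeRing commutativeRing
    module P = RingProperties R.ring
    open ≡-Reasoning

    -ᵛ≡0ᵛ : ∀ {d} (x y : Point d) → x -ᵛ y ≡ 0ᵛ → x ≡ y
    -ᵛ≡0ᵛ []      []      _  = refl
    -ᵛ≡0ᵛ (a ∷ x) (b ∷ y) eq = cong₂ _∷_
      (P.x∙y⁻¹≈ε⇒x≈y a b (proj₁ (∷-injective eq)))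
      (-ᵛ≡0ᵛ x y (proj₂ (∷-injective eq)))

    +ᵛ-0*ᵛ : ∀ {d} (y v : Point d) → y ≡ y +ᵛ 0# *ᵛ v
    +ᵛ-0*ᵛ []      []      = refl
    +ᵛ-0*ᵛ (b ∷ y) (a ∷ v) = cong₂ _∷_
      (sym (trans (cong (b +_) (R.zeroˡ a)) (R.+-identityʳ b))) (+ᵛ-0*ᵛ y v)

    cancel : ∀ s r → s + (r + - s) ≡ r
    cancel s r = begin
      s + (r + - s)  ≡⟨ cong (s +_) (R.+-comm r (- s)) ⟩
      s + (- s + r)  ≡⟨ R.+-assoc s (- s) r ⟨
      s + - s + r    ≡⟨ cong (_+ r) (R.-‿inverseʳ s) ⟩
      0# + r         ≡⟨ R.+-identityˡ r ⟩
      r              ∎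

    +ᵛ-1*ᵛ : ∀ {d} (x y : Point d) → x ≡ y +ᵛ 1# *ᵛ (x -ᵛ y)
    +ᵛ-1*ᵛ []      []      = refl
    +ᵛ-1*ᵛ (a ∷ x) (b ∷ y) = cong₂ _∷_
      (sym (trans (cong (b +_) (R.*-identityˡ _)) (cancel b a))) (+ᵛ-1*ᵛ x y)

    combine : ∀ {d} (b v : Point d) s t u →
      (b +ᵛ s *ᵛ v) +ᵛ u *ᵛ ((b +ᵛ t *ᵛ v) -ᵛ (b +ᵛ s *ᵛ v)) ≡ b +ᵛ (s + u * (t + - s)) *ᵛ v
    combine []      []      s t u = refl
    combine (b ∷ bs) (a ∷ v) s t u = cong₂ _∷_ eq (combine bs v s t u)
      where
      difference : (b + t * a) + - (b + s * a) ≡ (t + - s) * a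
      difference = begin
        (b + t * a) + - (b + s * a)      ≡⟨ cong (_+ - (b + s * a)) (R.+-comm b (t * a)) ⟩
        (t * a + b) + - (b + s * a)      ≡⟨ cong ((t * a + b) +_) (P.-‿+-comm b (s * a)) ⟨
        (t * a + b) + (- b + - (s * a))  ≡⟨ R.+-assoc (t * a) b _ ⟩
        t * a + (b + (- b + - (s * a)))  ≡⟨ cong (t * a +_) (R.+-assoc b (- b) _) ⟨
        t * a + (b + - b + - (s * a))    ≡⟨ cong (λ z → t * a + (z + - (s * a))) (R.-‿inverseʳ b) ⟩
        t * a + (0# + - (s * a))         ≡⟨ cong (t * a +_) (R.+-identityˡ _) ⟩
        t * a + - (s * a)                ≡⟨ cong (t * a +_) (P.-‿distribˡ-* s a) ⟩
        t * a + - s * a                  ≡⟨ R.distribʳ a t (- s) ⟨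
        (t + - s) * a                    ∎
      eq : (b + s * a) + u * ((b + t * a) + - (b + s * a)) ≡ b + (s + u * (t + - s)) * a
      eq = begin
        (b + s * a) + u * ((b + t * a) + - (b + s * a))  ≡⟨ cong (λ z → (b + s * a) + u * z) difference ⟩
        (b + s * a) + u * ((t + - s) * a)                ≡⟨ cong ((b + s * a) +_) (R.*-assoc u _ a) ⟨
        (b + s * a) + u * (t + - s) * a                  ≡⟨ R.+-assoc b (s * a) _ ⟩
        b + (s * a + u * (t + - s) * a)                  ≡⟨ cong (b +_) (R.distribʳ a s _) ⟨
        b + (s + u * (t + - s)) * a                      ∎

  -- π y x is the unique line containing x and y, by the three lemmas below.
  π : ∀ {d} (y x : Point d) → x ≢ y → Line d
  π y x x≢y = line y (x -ᵛ y) (x≢y ∘ -ᵛ≡0ᵛ x y)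

  y∈π : ∀ {d} (y x : Point d) (x≢y : x ≢ y) → y ∈ᴸ π y x x≢y
  y∈π y x x≢y = 0# , +ᵛ-0*ᵛ y (x -ᵛ y)

  x∈π : ∀ {d} (y x : Point d) (x≢y : x ≢ y) → x ∈ᴸ π y x x≢y
  x∈π y x x≢y = 1# , +ᵛ-1*ᵛ x y

  π-unique : ∀ {d} (y x : Point d) (x≢y : x ≢ y) (ℓ : Line d) →
             y ∈ᴸ ℓ → x ∈ᴸ ℓ → ℓ ≈ᴸ π y x x≢y
  π-unique _ _ x≢y (line b v _) (s , refl) (t , refl) p = mk⇔
    (λ (r , p≡) → (r + - s) * w , trans p≡ (sym (trans (combine b v s t _) (cong (λ z → b +ᵛ z *ᵛ v) (solves r)))))
    (λ (u , p≡) → _ , trans p≡ (combine b v s t u))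
    where
    t≢s : t ≢ s
    t≢s refl = x≢y refl
    w : Carrier
    w = proj₁ (#⇒invertible t≢s)
    solves : ∀ r → s + (r + - s) * w * (t + - s) ≡ r
    solves r = begin
      s + (r + - s) * w * (t + - s)    ≡⟨ cong (s +_) (R.*-assoc _ w _) ⟩
      s + (r + - s) * (w * (t + - s))  ≡⟨ cong (λ z → s + (r + - s) * z) (proj₁ (proj₂ (#⇒invertible t≢s))) ⟩
      s + (r + - s) * 1#               ≡⟨ cong (s +_) (R.*-identityʳ _) ⟩
      s + (r + - s)                    ≡⟨ cancel s r ⟩
      r                                ∎

  -- The radial projection π^y, undefined at y itself.
  project : ∀ {d} → Point d → Point d → Maybe (Line d)
  project y x with x ≟ᵛ y
  ... | yes _   = nothing
  ... | no  x≢y = just (π y x x≢y)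

  -- The lines π^y(x) for x ∈ E \ {y}, possibly with repetitions.
  radialLines : ∀ {ℓ d} {E : Pred (Point d) ℓ} → Point d → Decidable E → List (Line d)
  radialLines {d = d} y E? = mapMaybe (project y) (filter E? (points d))

  -- |π^y(E)|
  cardRadial : ∀ {ℓ d} {E : Pred (Point d) ℓ} → Point d → Decidable E → ℕ
  cardRadial y E? = length (deduplicate _≈ᴸ?_ (radialLines y E?))

{-# OPTIONS --safe #-}
-- Second moments over random affine subspaces of codimension k.  A block is a
-- k-tuple of affine functionals, read as their common zero set; the blocks
-- form a 2-design: a point lies in KQ of the KQ² blocks and two distinct points
-- in K of them, where Q = q^k.  For a block β put g(β) = |E ∩ β|, and let f(β)
-- count the y ∈ Y ∩ β for which β contains a point of E other than y.  A block
-- of this kind through y contains a line of π^y(E), so there are at most mK of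
-- them when |π^y(E)| ≤ m.  Hence ∑f and ∑f² are small although ∑fg ≥ K|Y|(|E| - 1),
-- while g has mean |E|/Q and variance at most |E|/Q.  Summing
-- (Q²f - |Y|(Qg - |E|))² ≥ 0 over all blocks gives |Y||E| = O(Qm).
module Submission where

open import Defs
open import Level using (Level)
open import Data.Nat.Base using (ℕ; suc; _*_; _^_; _≤_; _<_)
open import Data.Integer.Base using (ℤ; +_) renaming (_≤_ to _≤ℤ_; _<_ to _<ℤ_; _*_ to _*ℤ_)
open import Data.Integer.Properties using (_≤?_)
open import Relation.Unary using (Pred; Decidable)

open import Algebra.Bundles using (CommutativeRing)
import Algebra.Properties.CommutativeSemigroup as CommutativeSemigroupProperties
import Algebra.Properties.Ring as RingProperties
open import Data.Integer.Base using (+<+; -≤+; -[1+_])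
import Data.Integer.Properties as ℤ
open import Data.Fin.Properties using (nonZeroIndex)
open import Data.List.Base using (List; []; _∷_; _++_; allFin; cartesianProductWith; deduplicate; filter; length; map)
open import Data.List.Membership.Propositional using (_∈_; lose; find)
open import Data.List.Membership.Propositional.Properties using (∈-filter⁻)
open import Data.List.Properties using (map-++; map-∘; length-map; length-tabulate)
open import Data.List.Relation.Unary.All as All using (All)
open import Data.List.Relation.Unary.AllPairs using (_∷_)
open import Data.List.Relation.Unary.Any as Any using (Any; here; there)
import Data.List.Relation.Unary.Any.Properties as Any
open import Data.List.Relation.Unary.Unique.Propositional using (Unique)
import Data.List.Relation.Unary.Unique.Propositional.Properties as Unique
import Data.Maybe.Relation.Unary.Any as Maybe
open import Data.Nat.Base using (zero; _+_; NonZero; z≤n; s≤s; >-nonZero; >-nonZero⁻¹; ≢-nonZero)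
open import Data.Nat.ListAction using (sum)
open import Data.Nat.ListAction.Properties using (sum-++)
open import Data.Nat.Properties hiding (_≤?_; +-commutativeSemigroup; *-commutativeSemigroup)
open import Data.Nat.Tactic.RingSolver using (solve-∀)
open import Data.Product.Base using (Σ; _×_; _,_; proj₁; proj₂)
open import Data.Sum.Base using (inj₁; inj₂)
open import Data.Vec.Base using (Vec; []; _∷_)
open import Data.Vec.Properties using (∷-injective)
import Data.Vec.Relation.Unary.All as Vec
open import Function.Base using (_∘_)
open import Function.Bundles using (_⇔_; mk⇔; module Equivalence; module Inverse)
open import Relation.Binary.Definitions using (DecidableEquality)
open import Relation.Binary.PropositionalEquality
open import Relation.Nullary using (Dec; yes; no; ¬_; ¬?; _×-dec_; contradiction; from-yes)

private
  variable
    a p r : Level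
    A B C : Set a
    P : Set p
    R : Set r

-- Indicators of decidable propositions.

⟦_⟧ : Dec P → ℕ
⟦ yes _ ⟧ = 1
⟦ no _ ⟧  = 0

⟦⟧-true : (P? : Dec P) → P → ⟦ P? ⟧ ≡ 1
⟦⟧-true (yes _) _  = refl
⟦⟧-true (no ¬p) p′ = contradiction p′ ¬p

⟦⟧-false : (P? : Dec P) → ¬ P → ⟦ P? ⟧ ≡ 0
⟦⟧-false (yes p′) ¬p = contradiction p′ ¬p
⟦⟧-false (no _)   _  = refl

⟦⟧-mono : (P → R) → (P? : Dec P) (R? : Dec R) → ⟦ P? ⟧ ≤ ⟦ R? ⟧
⟦⟧-mono f (yes p′) R? = ≤-reflexive (sym (⟦⟧-true R? (f p′)))
⟦⟧-mono f (no _)   R? = z≤n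

⟦⟧-cong : P ⇔ R → (P? : Dec P) (R? : Dec R) → ⟦ P? ⟧ ≡ ⟦ R? ⟧
⟦⟧-cong P⇔R P? R? = ≤-antisym (⟦⟧-mono (Equivalence.to P⇔R) P? R?) (⟦⟧-mono (Equivalence.from P⇔R) R? P?)

⟦⟧-×-dec : (P? : Dec P) (R? : Dec R) → ⟦ P? ×-dec R? ⟧ ≡ ⟦ P? ⟧ * ⟦ R? ⟧
⟦⟧-×-dec (yes _) (yes _) = refl
⟦⟧-×-dec (yes _) (no _)  = refl
⟦⟧-×-dec (no _)  _       = refl

-- Finite sums over lists.

∑ : List A → (A → ℕ) → ℕ
∑ xs f = sum (map f xs)

∑-mono : ∀ (xs : List A) {f g : A → ℕ} → (∀ {x} → x ∈ xs → f x ≤ g x) → ∑ xs f ≤ ∑ xs g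
∑-mono []       f≤g = z≤n
∑-mono (x ∷ xs) f≤g = +-mono-≤ (f≤g (here refl)) (∑-mono xs (f≤g ∘ there))

∑-cong : ∀ (xs : List A) {f g : A → ℕ} → (∀ x → f x ≡ g x) → ∑ xs f ≡ ∑ xs g
∑-cong []       f≡g = refl
∑-cong (x ∷ xs) f≡g = cong₂ _+_ (f≡g x) (∑-cong xs f≡g)

∑-const : ∀ (xs : List A) c → ∑ xs (λ _ → c) ≡ length xs * c
∑-const []       c = refl
∑-const (x ∷ xs) c = cong (_+_ c) (∑-const xs c)

∑-+ : ∀ (xs : List A) (f g : A → ℕ) → ∑ xs (λ x → f x + g x) ≡ ∑ xs f + ∑ xs g
∑-+ []       f g = refl
∑-+ (x ∷ xs) f g = begin
  f x + g x + ∑ xs (λ x → f x + g x)  ≡⟨ cong (_+_ (f x + g x)) (∑-+ xs f g) ⟩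
  f x + g x + (∑ xs f + ∑ xs g)       ≡⟨ exchange (f x) (g x) _ _ ⟩
  f x + ∑ xs f + (g x + ∑ xs g)       ∎
  where
  open ≡-Reasoning
  exchange : ∀ s t u v → s + t + (u + v) ≡ s + u + (t + v)
  exchange = solve-∀

∑-*ˡ : ∀ (xs : List A) c (f : A → ℕ) → ∑ xs (λ x → c * f x) ≡ c * ∑ xs f
∑-*ˡ []       c f = sym (*-zeroʳ c)
∑-*ˡ (x ∷ xs) c f = trans (cong (_+_ (c * f x)) (∑-*ˡ xs c f)) (sym (*-distribˡ-+ c _ _))

∑-*ʳ : ∀ (xs : List A) c (f : A → ℕ) → ∑ xs (λ x → f x * c) ≡ ∑ xs f * c
∑-*ʳ xs c f = begin
  ∑ xs (λ x → f x * c)  ≡⟨ ∑-cong xs (λ x → *-comm (f x) c) ⟩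
  ∑ xs (λ x → c * f x)  ≡⟨ ∑-*ˡ xs c f ⟩
  c * ∑ xs f            ≡⟨ *-comm c _ ⟩
  ∑ xs f * c            ∎
  where open ≡-Reasoning

∑-swap : ∀ (xs : List A) (ys : List B) (f : A → B → ℕ) →
         ∑ xs (λ x → ∑ ys (f x)) ≡ ∑ ys (λ y → ∑ xs (λ x → f x y))
∑-swap []       ys f = sym (trans (∑-const ys 0) (*-zeroʳ (length ys)))
∑-swap (x ∷ xs) ys f = trans (cong (_+_ (∑ ys (f x))) (∑-swap xs ys f)) (sym (∑-+ ys _ _))

∑-* : ∀ (xs : List A) (ys : List B) (f : A → ℕ) (g : B → ℕ) →
      ∑ xs f * ∑ ys g ≡ ∑ xs (λ x → ∑ ys (λ y → f x * g y))
∑-* xs ys f g = trans (sym (∑-*ʳ xs (∑ ys g) f)) (∑-cong xs (λ x → sym (∑-*ˡ ys (f x) g)))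

∑-++ : ∀ (xs ys : List A) (f : A → ℕ) → ∑ (xs ++ ys) f ≡ ∑ xs f + ∑ ys f
∑-++ xs ys f = trans (cong sum (map-++ f xs ys)) (sum-++ (map f xs) (map f ys))

∑-cartesianProductWith : ∀ (h : A → B → C) xs ys (f : C → ℕ) →
  ∑ (cartesianProductWith h xs ys) f ≡ ∑ xs (λ x → ∑ ys (λ y → f (h x y)))
∑-cartesianProductWith h []       ys f = refl
∑-cartesianProductWith h (x ∷ xs) ys f = trans (∑-++ (map (h x) ys) _ f)
  (cong₂ _+_ (cong sum (sym (map-∘ ys))) (∑-cartesianProductWith h xs ys f))

≤-∑ : ∀ {xs : List A} (f : A → ℕ) {x} → x ∈ xs → f x ≤ ∑ xs f
≤-∑ f (here refl)  = m≤m+n _ _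
≤-∑ f (there x∈xs) = ≤-trans (≤-∑ f x∈xs) (m≤n+m _ _)

∑-none : ∀ {P : A → Set p} (P? : Decidable P) {xs} → All (¬_ ∘ P) xs → ∑ xs (λ x → ⟦ P? x ⟧) ≡ 0
∑-none P? All.[]         = refl
∑-none P? (¬p All.∷ ¬ps) = cong₂ _+_ (⟦⟧-false (P? _) ¬p) (∑-none P? ¬ps)

-- An inequality, because `y` may be absent from `xs`: in the second moment argument a point of `Y`
-- is looked up in `E`.
∑-point : (_≟_ : DecidableEquality A) → ∀ y {xs} → Unique xs → ∑ xs (λ x → ⟦ x ≟ y ⟧) ≤ 1
∑-point _≟_ y {[]}     _            = z≤n
∑-point _≟_ y {x ∷ xs} (x∉xs ∷ uxs) with x ≟ y
... | yes refl = ≤-reflexive (cong suc (∑-none (_≟ y) (All.map ≢-sym x∉xs)))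
... | no _     = ∑-point _≟_ y uxs

∑-unique : (_≟_ : DecidableEquality A) {P : A → Set p} (P? : Decidable P) {y : A} {xs : List A} →
           Unique xs → y ∈ xs → (∀ x → P x ⇔ x ≡ y) → ∑ xs (λ x → ⟦ P? x ⟧) ≡ 1
∑-unique _≟_ P? {y} {xs} uxs y∈xs P⇔ = ≤-antisym
  (≤-trans (≤-reflexive (∑-cong xs (λ x → ⟦⟧-cong (P⇔ x) (P? x) (x ≟ y)))) (∑-point _≟_ y uxs))
  (≤-trans (≤-reflexive (sym (⟦⟧-true (P? y) (Equivalence.from (P⇔ y) refl)))) (≤-∑ (λ x → ⟦ P? x ⟧) y∈xs))

-- Counting tuples.

tuples : List A → ∀ k → List (Vec A k)
tuples xs zero    = [] ∷ []
tuples xs (suc k) = cartesianProductWith _∷_ xs (tuples xs k)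

-- The entries of a tuple are constrained independently, so the indicator factors. This reduces
-- counting blocks to counting single functionals.
∑-tuples : ∀ {P : A → Set p} (P? : Decidable P) xs k →
           ∑ (tuples xs k) (λ v → ⟦ Vec.all? P? v ⟧) ≡ ∑ xs (λ x → ⟦ P? x ⟧) ^ k
∑-tuples P? xs zero    = refl
∑-tuples P? xs (suc k) = begin
  ∑ (tuples xs (suc k)) (λ v → ⟦ Vec.all? P? v ⟧)
    ≡⟨ ∑-cartesianProductWith _∷_ xs (tuples xs k) _ ⟩
  ∑ xs (λ x → ∑ (tuples xs k) (λ v → ⟦ Vec.all? P? (x ∷ v) ⟧))
    ≡⟨ ∑-cong xs (λ x → ∑-cong (tuples xs k) (λ v → split x v)) ⟩
  ∑ xs (λ x → ∑ (tuples xs k) (λ v → ⟦ P? x ⟧ * ⟦ Vec.all? P? v ⟧))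
    ≡⟨ ∑-* xs (tuples xs k) _ _ ⟨
  ∑ xs (λ x → ⟦ P? x ⟧) * ∑ (tuples xs k) (λ v → ⟦ Vec.all? P? v ⟧)
    ≡⟨ cong (_*_ (∑ xs (λ x → ⟦ P? x ⟧))) (∑-tuples P? xs k) ⟩
  ∑ xs (λ x → ⟦ P? x ⟧) ^ suc k ∎
  where
  open ≡-Reasoning
  split : ∀ x {k} (v : Vec _ k) → ⟦ Vec.all? P? (x ∷ v) ⟧ ≡ ⟦ P? x ⟧ * ⟦ Vec.all? P? v ⟧
  split x v = trans
    (⟦⟧-cong (mk⇔ Vec.uncons (λ (px , pv) → px Vec.∷ pv)) (Vec.all? P? (x ∷ v)) (P? x ×-dec Vec.all? P? v))
    (⟦⟧-×-dec (P? x) (Vec.all? P? v))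

length-cartesianProductWith : ∀ (h : A → B → C) xs ys →
  length (cartesianProductWith h xs ys) ≡ length xs * length ys
length-cartesianProductWith h xs ys = begin
  length (cartesianProductWith h xs ys)        ≡⟨ count (cartesianProductWith h xs ys) ⟩
  ∑ (cartesianProductWith h xs ys) (λ _ → 1)   ≡⟨ ∑-cartesianProductWith h xs ys _ ⟩
  ∑ xs (λ _ → ∑ ys (λ _ → 1))                  ≡⟨ ∑-const xs _ ⟩
  length xs * ∑ ys (λ _ → 1)                   ≡⟨ cong (_*_ (length xs)) (count ys) ⟨
  length xs * length ys                        ∎
  where
  open ≡-Reasoning
  count : ∀ {a} {A : Set a} (xs : List A) → length xs ≡ ∑ xs (λ _ → 1)
  count xs = sym (trans (∑-const xs 1) (*-identityʳ _))

length-tuples : ∀ (xs : List A) k → length (tuples xs k) ≡ length xs ^ k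
length-tuples xs zero    = refl
length-tuples xs (suc k) = trans (length-cartesianProductWith _∷_ xs (tuples xs k))
  (cong (_*_ (length xs)) (length-tuples xs k))

-- Polynomial inequalities for the second moments.

2xy≤x²+y² : ∀ x y → 2 * (x * y) ≤ x * x + y * y
2xy≤x²+y² x y with ≤-total x y
-- The two sides differ by the square of `o`, the difference of the larger and the smaller number.
... | inj₁ x≤y with o , refl ← m≤n⇒∃[o]m+o≡n x≤y = ≤-trans (m≤m+n _ (o * o)) (≤-reflexive (expand x o))
  where
  expand : ∀ x o → 2 * (x * (x + o)) + o * o ≡ x * x + (x + o) * (x + o)
  expand = solve-∀
... | inj₂ y≤x with o , refl ← m≤n⇒∃[o]m+o≡n y≤x = ≤-trans (m≤m+n _ (o * o)) (≤-reflexive (expand y o))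
  where
  expand : ∀ y o → 2 * ((y + o) * y) + o * o ≡ (y + o) * (y + o) + y * y
  expand = solve-∀

-- The square (Q²f - Y(Qg - e))² ≥ 0, with Q²f + Ye and YQg on opposite sides so
-- that no subtraction occurs.
second-moment-pointwise : ∀ Q Y e f g →
  2 * (Y * Q * Q * Q) * (f * g) + 2 * (Y * Y * Q * e) * g ≤
  Q * Q * Q * Q * (f * f) + 2 * (Q * Q * Y * e) * f + Y * Y * e * e + Y * Y * Q * Q * (g * g)
second-moment-pointwise Q Y e f g = begin
  2 * (Y * Q * Q * Q) * (f * g) + 2 * (Y * Y * Q * e) * g  ≡⟨ lhs Q Y e f g ⟩
  2 * ((Q * Q * f + Y * e) * (Y * Q * g))                  ≤⟨ 2xy≤x²+y² (Q * Q * f + Y * e) (Y * Q * g) ⟩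
  (Q * Q * f + Y * e) * (Q * Q * f + Y * e) + Y * Q * g * (Y * Q * g)  ≡⟨ rhs Q Y e f g ⟩
  Q * Q * Q * Q * (f * f) + 2 * (Q * Q * Y * e) * f + Y * Y * e * e + Y * Y * Q * Q * (g * g) ∎
  where
  open ≤-Reasoning
  lhs : ∀ Q Y e f g → 2 * (Y * Q * Q * Q) * (f * g) + 2 * (Y * Y * Q * e) * g ≡
        2 * ((Q * Q * f + Y * e) * (Y * Q * g))
  lhs = solve-∀
  rhs : ∀ Q Y e f g → (Q * Q * f + Y * e) * (Q * Q * f + Y * e) + Y * Q * g * (Y * Q * g) ≡
        Q * Q * Q * Q * (f * f) + 2 * (Q * Q * Y * e) * f + Y * Y * e * e + Y * Y * Q * Q * (g * g)
  rhs = solve-∀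

cancel-moments : ∀ {K Q Y} .{{_ : NonZero K}} .{{_ : NonZero Q}} .{{_ : NonZero Y}} {e m fg g² f² f₁} →
  Y * (e * K) ≤ fg + Y * K →
  g² ≤ e * (e * K + K * Q) →
  f² ≤ Y * (Y * K + m * K) →
  f₁ ≤ Y * (m * K) →
  2 * (Y * Q * Q * Q) * fg + 2 * (Y * Y * Q * e) * (e * (K * Q)) ≤
  Q * Q * Q * Q * f² + 2 * (Q * Q * Y * e) * f₁ + K * Q * Q * (Y * Y * e * e) + Y * Y * Q * Q * g² →
  Q * (Y * e) ≤ 2 * (Y * Q) + Q * Q * (Y + m) + 2 * (Y * e * m)
cancel-moments {K} {Q} {Y} {e} {m} {fg} {g²} {f²} {f₁} fg≥ g²≤ f²≤ f₁≤ main =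
  *-cancelˡ-≤ (Y * Q * Q * K) (+-cancelˡ-≤ rest _ _ (begin
    rest + Y * Q * Q * K * (Q * (Y * e))
      ≡⟨ lhs K Q Y e ⟩
    2 * (Y * Q * Q * Q) * (Y * (e * K)) + 2 * (Y * Y * Q * e) * (e * (K * Q))
      ≤⟨ +-monoˡ-≤ _ (*-monoʳ-≤ (2 * (Y * Q * Q * Q)) fg≥) ⟩
    2 * (Y * Q * Q * Q) * (fg + Y * K) + 2 * (Y * Y * Q * e) * (e * (K * Q))
      ≡⟨ regroup (2 * (Y * Q * Q * Q)) fg (Y * K) _ ⟩
    2 * (Y * Q * Q * Q) * fg + 2 * (Y * Y * Q * e) * (e * (K * Q)) + 2 * (Y * Q * Q * Q) * (Y * K)
      ≤⟨ +-monoˡ-≤ _ main ⟩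
    Q * Q * Q * Q * f² + 2 * (Q * Q * Y * e) * f₁ + K * Q * Q * (Y * Y * e * e) + Y * Y * Q * Q * g²
      + 2 * (Y * Q * Q * Q) * (Y * K)
      ≤⟨ +-monoˡ-≤ _ (+-mono-≤ (+-monoˡ-≤ _ (+-mono-≤
           (*-monoʳ-≤ (Q * Q * Q * Q) f²≤) (*-monoʳ-≤ (2 * (Q * Q * Y * e)) f₁≤)))
           (*-monoʳ-≤ (Y * Y * Q * Q) g²≤)) ⟩
    Q * Q * Q * Q * (Y * (Y * K + m * K)) + 2 * (Q * Q * Y * e) * (Y * (m * K))
      + K * Q * Q * (Y * Y * e * e) + Y * Y * Q * Q * (e * (e * K + K * Q)) + 2 * (Y * Q * Q * Q) * (Y * K)
      ≡⟨ rhs K Q Y e m ⟩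
    rest + Y * Q * Q * K * (2 * (Y * Q) + Q * Q * (Y + m) + 2 * (Y * e * m)) ∎))
  where
  open ≤-Reasoning
  instance
    Y*Q≢0 = m*n≢0 Y Q
    Y*Q*Q≢0 = m*n≢0 (Y * Q) Q
    Y*Q*Q*K≢0 = m*n≢0 (Y * Q * Q) K
  -- The first summand comes from the squared means and occurs in full on both sides. The second is
  -- the variance of g; it uses up half of the main term 2Y²Q³eK, and the other half survives on the
  -- left.
  rest : ℕ
  rest = 2 * (Y * Y * Q * Q * e * e * K) + Y * Y * Q * Q * Q * e * K
  regroup : ∀ c s t u → c * (s + t) + u ≡ c * s + u + c * t
  regroup = solve-∀
  lhs : ∀ K Q Y e → 2 * (Y * Y * Q * Q * e * e * K) + Y * Y * Q * Q * Q * e * K + Y * Q * Q * K * (Q * (Y * e)) ≡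
        2 * (Y * Q * Q * Q) * (Y * (e * K)) + 2 * (Y * Y * Q * e) * (e * (K * Q))
  lhs = solve-∀
  rhs : ∀ K Q Y e m → Q * Q * Q * Q * (Y * (Y * K + m * K)) + 2 * (Q * Q * Y * e) * (Y * (m * K))
      + K * Q * Q * (Y * Y * e * e) + Y * Y * Q * Q * (e * (e * K + K * Q)) + 2 * (Y * Q * Q * Q) * (Y * K) ≡
      2 * (Y * Y * Q * Q * e * e * K) + Y * Y * Q * Q * Q * e * K
      + Y * Q * Q * K * (2 * (Y * Q) + Q * Q * (Y + m) + 2 * (Y * e * m))
  rhs = solve-∀

-- Second moments over a 2-design.

module Design {a b i} {A : Set a} {B : Set b} (_≟_ : DecidableEquality A)
  {_∈ᴮ_ : A → B → Set i} (_∈ᴮ?_ : ∀ x β → Dec (x ∈ᴮ β))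
  (blocks : List B) (K Q : ℕ) .{{_ : NonZero K}} .{{_ : NonZero Q}}
  -- For a uniformly random block these three counts say that each point is covered with probability
  -- 1/Q and that distinct points are covered pairwise independently.
  (∣blocks∣ : length blocks ≡ K * Q * Q)
  (degree : ∀ x → ∑ blocks (λ β → ⟦ x ∈ᴮ? β ⟧) ≡ K * Q)
  (codegree : ∀ {x y} → x ≢ y → ∑ blocks (λ β → ⟦ x ∈ᴮ? β ×-dec y ∈ᴮ? β ⟧) ≡ K)
  where

  module _ (E : List A) where

    -- The clause `x ≢ y` is there because `y` may belong to `E`, while the radial projection from
    -- `y` discards `y` itself.
    Secant : A → B → Set _
    Secant y β = y ∈ᴮ β × Any (λ x → x ≢ y × x ∈ᴮ β) E

    secant? : ∀ y β → Dec (Secant y β)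
    secant? y β = y ∈ᴮ? β ×-dec Any.any? (λ x → ¬? (x ≟ y) ×-dec x ∈ᴮ? β) E

  module _ {E Y : List A} (E-unique : Unique E) (Y-unique : Unique Y) (m : ℕ)
    -- The bound on the radial projection enters in this form only; in the application `K` is the
    -- number of blocks containing a given line.
    (secants≤ : ∀ {y} → y ∈ Y → ∑ blocks (λ β → ⟦ secant? E y β ⟧) ≤ m * K) where

    private
      ∣E∣ ∣Y∣ : ℕ
      ∣E∣ = length E
      ∣Y∣ = length Y

      f g : B → ℕ
      f β = ∑ Y (λ y → ⟦ secant? E y β ⟧)
      g β = ∑ E (λ x → ⟦ x ∈ᴮ? β ⟧)

      -- Expanding the product and summing over the blocks first reduces every second moment to
      -- counting the blocks for a fixed pair of points.
      ∑₂ : ∀ {c d} {C : Set c} {D : Set d} (xs : List C) (ys : List D) (u : C → B → ℕ) (v : D → B → ℕ) →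
        ∑ blocks (λ β → ∑ xs (λ x → u x β) * ∑ ys (λ y → v y β)) ≡
        ∑ xs (λ x → ∑ ys (λ y → ∑ blocks (λ β → u x β * v y β)))
      ∑₂ xs ys u v = begin
        ∑ blocks (λ β → ∑ xs (λ x → u x β) * ∑ ys (λ y → v y β))
          ≡⟨ ∑-cong blocks (λ β → ∑-* xs ys _ _) ⟩
        ∑ blocks (λ β → ∑ xs (λ x → ∑ ys (λ y → u x β * v y β)))
          ≡⟨ ∑-swap blocks xs _ ⟩
        ∑ xs (λ x → ∑ blocks (λ β → ∑ ys (λ y → u x β * v y β)))
          ≡⟨ ∑-cong xs (λ x → ∑-swap blocks ys _) ⟩
        ∑ xs (λ x → ∑ ys (λ y → ∑ blocks (λ β → u x β * v y β))) ∎
        where open ≡-Reasoning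

      ∑-diagonal : ∀ {xs} → Unique xs → ∀ y c t →
        ∑ xs (λ x → c + t * ⟦ x ≟ y ⟧) ≤ length xs * c + t
      ∑-diagonal {xs} uxs y c t = begin
        ∑ xs (λ x → c + t * ⟦ x ≟ y ⟧)              ≡⟨ ∑-+ xs _ _ ⟩
        ∑ xs (λ _ → c) + ∑ xs (λ x → t * ⟦ x ≟ y ⟧)  ≡⟨ cong₂ _+_ (∑-const xs c) (∑-*ˡ xs t _) ⟩
        length xs * c + t * ∑ xs (λ x → ⟦ x ≟ y ⟧)   ≤⟨ +-monoʳ-≤ _ (*-monoʳ-≤ t (∑-point _≟_ y uxs)) ⟩
        length xs * c + t * 1                       ≡⟨ cong (_+_ (length xs * c)) (*-identityʳ t) ⟩
        length xs * c + t                           ∎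
        where open ≤-Reasoning

      -- Each diagonal pair is charged `c` as well as `t`, which avoids `length xs` minus one. The
      -- diagonal hypothesis asks for membership because `secants≤` is available on `Y` only.
      ∑-off-diagonal : ∀ {xs} → Unique xs → ∀ c t (u : A → A → ℕ) →
        (∀ {x y} → x ≢ y → u y x ≤ c) → (∀ {y} → y ∈ xs → u y y ≤ t) →
        ∑ xs (λ y → ∑ xs (u y)) ≤ length xs * (length xs * c + t)
      ∑-off-diagonal {xs} uxs c t u off on = begin
        ∑ xs (λ y → ∑ xs (u y))                         ≤⟨ ∑-mono xs (λ {y} y∈ → ∑-mono xs (λ {x} _ → bound y∈ x)) ⟩
        ∑ xs (λ y → ∑ xs (λ x → c + t * ⟦ x ≟ y ⟧))     ≤⟨ ∑-mono xs (λ {y} _ → ∑-diagonal uxs y c t) ⟩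
        ∑ xs (λ y → length xs * c + t)                  ≡⟨ ∑-const xs _ ⟩
        length xs * (length xs * c + t)                 ∎
        where
        open ≤-Reasoning
        bound : ∀ {y} → y ∈ xs → ∀ x → u y x ≤ c + t * ⟦ x ≟ y ⟧
        bound {y} y∈ x with x ≟ y
        ... | yes refl = ≤-trans (on y∈) (≤-trans (≤-reflexive (sym (*-identityʳ t))) (m≤n+m _ c))
        ... | no x≢y   = ≤-trans (off x≢y) (m≤m+n c _)

      ∑g : ∑ blocks g ≡ ∣E∣ * (K * Q)
      ∑g = trans (∑-swap blocks E _) (trans (∑-cong E degree) (∑-const E _))

      ∑f≤ : ∑ blocks f ≤ ∣Y∣ * (m * K)
      ∑f≤ = ≤-trans (≤-reflexive (∑-swap blocks Y _))
        (≤-trans (∑-mono Y secants≤) (≤-reflexive (∑-const Y _)))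

      -- Distinct points contribute the codegree, equal points the degree. The part
      -- `∣E∣ * (∣E∣ * K)` is the squared mean of `g` times the number of blocks, so the rest bounds
      -- the variance.
      ∑g²≤ : ∑ blocks (λ β → g β * g β) ≤ ∣E∣ * (∣E∣ * K + K * Q)
      ∑g²≤ = ≤-trans (≤-reflexive (∑₂ E E _ _)) (∑-off-diagonal E-unique K (K * Q) _
        (λ {x} {y} x≢y → ≤-reflexive (trans
          (∑-cong blocks (λ β → sym (⟦⟧-×-dec (y ∈ᴮ? β) (x ∈ᴮ? β)))) (codegree (≢-sym x≢y))))
        (λ {y} _ → ≤-reflexive (trans (∑-cong blocks (λ β → sym (⟦⟧-×-dec (y ∈ᴮ? β) (y ∈ᴮ? β))))
          (trans (∑-cong blocks (λ β → ⟦⟧-cong (mk⇔ proj₁ (λ y∈ → y∈ , y∈)) (y ∈ᴮ? β ×-dec y ∈ᴮ? β) (y ∈ᴮ? β)))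
            (degree y)))))

      -- For distinct points the secant condition is weakened to incidence. On the diagonal it is
      -- kept, so that `m * K` stands where `∑g²≤` has the degree `K * Q`: this is the gain from
      -- small projections.
      ∑f²≤ : ∑ blocks (λ β → f β * f β) ≤ ∣Y∣ * (∣Y∣ * K + m * K)
      ∑f²≤ = ≤-trans (≤-reflexive (∑₂ Y Y _ _)) (∑-off-diagonal Y-unique K (m * K) _
        (λ {x} {y} x≢y → ≤-trans
          (∑-mono blocks (λ {β} _ → begin
            ⟦ secant? E y β ⟧ * ⟦ secant? E x β ⟧  ≡⟨ ⟦⟧-×-dec (secant? E y β) (secant? E x β) ⟨
            ⟦ secant? E y β ×-dec secant? E x β ⟧  ≤⟨ ⟦⟧-mono (λ (s , t) → proj₁ s , proj₁ t)
                                                       (secant? E y β ×-dec secant? E x β) (y ∈ᴮ? β ×-dec x ∈ᴮ? β) ⟩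
            ⟦ y ∈ᴮ? β ×-dec x ∈ᴮ? β ⟧              ∎))
          (≤-reflexive (codegree (≢-sym x≢y))))
        (λ {y} y∈ → ≤-trans
          (∑-mono blocks (λ {β} _ → begin
            ⟦ secant? E y β ⟧ * ⟦ secant? E y β ⟧  ≡⟨ ⟦⟧-×-dec (secant? E y β) (secant? E y β) ⟨
            ⟦ secant? E y β ×-dec secant? E y β ⟧  ≤⟨ ⟦⟧-mono proj₁ (secant? E y β ×-dec secant? E y β) (secant? E y β) ⟩
            ⟦ secant? E y β ⟧                      ∎))
          (secants≤ y∈)))
        where open ≤-Reasoning

      -- A block through `y` and a different point `x` of `E` is automatically secant at `y`, with
      -- `x` as witness, so every such pair keeps its full codegree. The extra `∣Y∣ * K` pays for
      -- the pairs with `x` equal to `y`.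
      ≤∑fg : ∣Y∣ * (∣E∣ * K) ≤ ∑ blocks (λ β → f β * g β) + ∣Y∣ * K
      ≤∑fg = begin
        ∣Y∣ * (∣E∣ * K)                               ≡⟨ ∑-const Y _ ⟨
        ∑ Y (λ _ → ∣E∣ * K)                           ≤⟨ ∑-mono Y (λ {y} _ → row y) ⟩
        ∑ Y (λ y → ∑ E (λ x → pairs y x) + K)         ≡⟨ ∑-+ Y _ _ ⟩
        ∑ Y (λ y → ∑ E (pairs y)) + ∑ Y (λ _ → K)     ≡⟨ cong₂ _+_ (sym (∑₂ Y E _ _)) (∑-const Y K) ⟩
        ∑ blocks (λ β → f β * g β) + ∣Y∣ * K          ∎
        where
        open ≤-Reasoning
        pairs : A → A → ℕ
        pairs y x = ∑ blocks (λ β → ⟦ secant? E y β ⟧ * ⟦ x ∈ᴮ? β ⟧)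
        entry : ∀ y {x} → x ∈ E → K ≤ pairs y x + K * ⟦ x ≟ y ⟧
        entry y {x} x∈E with x ≟ y
        ... | yes _  = ≤-trans (≤-reflexive (sym (*-identityʳ K))) (m≤n+m _ _)
        ... | no x≢y = ≤-trans (begin
          K                                               ≡⟨ codegree (≢-sym x≢y) ⟨
          ∑ blocks (λ β → ⟦ y ∈ᴮ? β ×-dec x ∈ᴮ? β ⟧)
            ≤⟨ ∑-mono blocks (λ {β} _ → ⟦⟧-mono (λ (y∈ , x∈) → (y∈ , lose x∈E (x≢y , x∈)) , x∈)
                 (y ∈ᴮ? β ×-dec x ∈ᴮ? β) (secant? E y β ×-dec x ∈ᴮ? β)) ⟩
          ∑ blocks (λ β → ⟦ secant? E y β ×-dec x ∈ᴮ? β ⟧)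
            ≡⟨ ∑-cong blocks (λ β → ⟦⟧-×-dec (secant? E y β) (x ∈ᴮ? β)) ⟩
          pairs y x                                       ∎) (m≤m+n _ _)
        row : ∀ y → ∣E∣ * K ≤ ∑ E (pairs y) + K
        row y = begin
          ∣E∣ * K                                             ≡⟨ ∑-const E K ⟨
          ∑ E (λ _ → K)                                       ≤⟨ ∑-mono E (entry y) ⟩
          ∑ E (λ x → pairs y x + K * ⟦ x ≟ y ⟧)               ≡⟨ ∑-+ E _ _ ⟩
          ∑ E (pairs y) + ∑ E (λ x → K * ⟦ x ≟ y ⟧)           ≤⟨ +-monoʳ-≤ _ (∑-diagonal E-unique y 0 K) ⟩
          ∑ E (pairs y) + (∣E∣ * 0 + K)                       ≡⟨ cong (λ z → ∑ E (pairs y) + (z + K)) (*-zeroʳ ∣E∣) ⟩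
          ∑ E (pairs y) + K                                   ∎

      second-moment : 2 * (∣Y∣ * Q * Q * Q) * ∑ blocks (λ β → f β * g β) + 2 * (∣Y∣ * ∣Y∣ * Q * ∣E∣) * ∑ blocks g ≤
        Q * Q * Q * Q * ∑ blocks (λ β → f β * f β) + 2 * (Q * Q * ∣Y∣ * ∣E∣) * ∑ blocks f
        + length blocks * (∣Y∣ * ∣Y∣ * ∣E∣ * ∣E∣) + ∣Y∣ * ∣Y∣ * Q * Q * ∑ blocks (λ β → g β * g β)
      second-moment = begin
        c₁ * ∑ blocks fg + c₂ * ∑ blocks g
          ≡⟨ cong₂ _+_ (∑-*ˡ blocks c₁ fg) (∑-*ˡ blocks c₂ g) ⟨
        ∑ blocks (λ β → c₁ * fg β) + ∑ blocks (λ β → c₂ * g β)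
          ≡⟨ ∑-+ blocks _ _ ⟨
        ∑ blocks (λ β → c₁ * fg β + c₂ * g β)
          ≤⟨ ∑-mono blocks (λ {β} _ → second-moment-pointwise Q ∣Y∣ ∣E∣ (f β) (g β)) ⟩
        ∑ blocks (λ β → c₃ * f² β + c₄ * f β + c₅ + c₆ * g² β)
          ≡⟨ trans (∑-+ blocks _ _) (cong₂ _+_ (trans (∑-+ blocks _ _) (cong₂ _+_ (trans (∑-+ blocks _ _)
               (cong₂ _+_ (∑-*ˡ blocks c₃ f²) (∑-*ˡ blocks c₄ f))) (∑-const blocks c₅))) (∑-*ˡ blocks c₆ g²)) ⟩
        c₃ * ∑ blocks f² + c₄ * ∑ blocks f + length blocks * c₅ + c₆ * ∑ blocks g² ∎
        where
        open ≤-Reasoning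
        fg f² g² : B → ℕ
        fg β = f β * g β
        f² β = f β * f β
        g² β = g β * g β
        c₁ c₂ c₃ c₄ c₅ c₆ : ℕ
        c₁ = 2 * (∣Y∣ * Q * Q * Q)
        c₂ = 2 * (∣Y∣ * ∣Y∣ * Q * ∣E∣)
        c₃ = Q * Q * Q * Q
        c₄ = 2 * (Q * Q * ∣Y∣ * ∣E∣)
        c₅ = ∣Y∣ * ∣Y∣ * ∣E∣ * ∣E∣
        c₆ = ∣Y∣ * ∣Y∣ * Q * Q

    few-secants-bound : .{{_ : NonZero ∣Y∣}} →
      Q * (∣Y∣ * ∣E∣) ≤ 2 * (∣Y∣ * Q) + Q * Q * (∣Y∣ + m) + 2 * (∣Y∣ * ∣E∣ * m)
    few-secants-bound = cancel-moments {K} {Q} {∣Y∣} ≤∑fg ∑g²≤ ∑f²≤ ∑f≤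
      -- The sum of `g` and the number of blocks are inserted exactly, since the terms quadratic in
      -- `∣E∣` have to cancel without loss.
      (subst₂ (λ s t → 2 * (∣Y∣ * Q * Q * Q) * ∑ blocks (λ β → f β * g β) + 2 * (∣Y∣ * ∣Y∣ * Q * ∣E∣) * s ≤
          Q * Q * Q * Q * ∑ blocks (λ β → f β * f β) + 2 * (Q * Q * ∣Y∣ * ∣E∣) * ∑ blocks f
          + t * (∣Y∣ * ∣Y∣ * ∣E∣ * ∣E∣) + ∣Y∣ * ∣Y∣ * Q * Q * ∑ blocks (λ β → g β * g β))
        ∑g ∣blocks∣ second-moment)

-- Counting affine functionals over a finite field.

module Hyperplanes {c q} (F : FiniteField c q) where

  open FiniteField F
    using (Carrier; 0#; 1#; elements; ∈-elements; elements-unique; enumeration; commutativeRing;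
           #⇒invertible; invertible⇒#)
    renaming (_+_ to _⊕_; _*_ to _⊗_; -_ to ⊖_; _≟_ to _≟ᶠ_)
  open Affine F
  private
    module R where
      open CommutativeRing commutativeRing public
      open RingProperties ring public
      open CommutativeSemigroupProperties +-commutativeSemigroup public using (interchange)
      open CommutativeSemigroupProperties *-commutativeSemigroup public using (x∙yz≈y∙xz)

  instance
    q≢0 : NonZero q
    q≢0 = nonZeroIndex (Inverse.to enumeration 0#)

  -- Distinctness is equivalent to invertibility of the difference, and 1 - 0 has the inverse 1.
  1≢0 : 1# ≢ 0#
  1≢0 = invertible⇒# (1# , 1⊗[1-0] , trans (R.*-comm _ _) 1⊗[1-0])
    where
    1⊗[1-0] : 1# ⊗ (1# ⊕ ⊖ 0#) ≡ 1#
    1⊗[1-0] = trans (R.*-identityˡ _) (trans (cong (1# ⊕_) R.-0#≈0#) (R.+-identityʳ 1#))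

  length-elements : length elements ≡ q
  length-elements = trans (length-map _ (allFin q)) (length-tabulate _)

  length-points : ∀ d → length (points d) ≡ q ^ d
  length-points zero    = refl
  length-points (suc d) = trans (length-cartesianProductWith _∷_ elements (points d))
    (cong₂ _*_ length-elements (length-points d))

  infix 8 _·_

  _·_ : ∀ {d} → Point d → Point d → Carrier
  []      · []      = 0#
  (a ∷ u) · (b ∷ v) = a ⊗ b ⊕ u · v

  ·-+ᵛ : ∀ {d} (u x y : Point d) → u · (x +ᵛ y) ≡ u · x ⊕ u · y
  ·-+ᵛ []      []      []      = sym (R.+-identityˡ 0#)
  ·-+ᵛ (a ∷ u) (b ∷ x) (e ∷ y) = trans (cong₂ _⊕_ (R.distribˡ a b e) (·-+ᵛ u x y)) (R.interchange _ _ _ _)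

  ·--ᵛ : ∀ {d} (u x y : Point d) → u · (x -ᵛ y) ≡ u · x ⊕ ⊖ (u · y)
  ·--ᵛ []      []      []      = sym (R.-‿inverseʳ 0#)
  ·--ᵛ (a ∷ u) (b ∷ x) (e ∷ y) = begin
    a ⊗ (b ⊕ ⊖ e) ⊕ u · (x -ᵛ y)                    ≡⟨ cong₂ _⊕_ (R.distribˡ a b (⊖ e)) (·--ᵛ u x y) ⟩
    a ⊗ b ⊕ a ⊗ ⊖ e ⊕ (u · x ⊕ ⊖ (u · y))           ≡⟨ R.interchange _ _ _ _ ⟩
    a ⊗ b ⊕ u · x ⊕ (a ⊗ ⊖ e ⊕ ⊖ (u · y))           ≡⟨ cong (λ z → a ⊗ b ⊕ u · x ⊕ (z ⊕ ⊖ (u · y))) (R.-‿distribʳ-* a e) ⟨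
    a ⊗ b ⊕ u · x ⊕ (⊖ (a ⊗ e) ⊕ ⊖ (u · y))         ≡⟨ cong (a ⊗ b ⊕ u · x ⊕_) (R.-‿+-comm _ _) ⟩
    a ⊗ b ⊕ u · x ⊕ ⊖ (a ⊗ e ⊕ u · y)               ∎
    where open ≡-Reasoning

  ·-*ᵛ : ∀ {d} (u : Point d) t v → u · (t *ᵛ v) ≡ t ⊗ (u · v)
  ·-*ᵛ []      t []      = sym (R.zeroʳ t)
  ·-*ᵛ (a ∷ u) t (b ∷ v) = trans (cong₂ _⊕_ (R.x∙yz≈y∙xz a t b) (·-*ᵛ u t v)) (sym (R.distribˡ t _ _))

  -- Puts the first coordinate innermost, so that a linear equation can be solved for it with the
  -- other coordinates fixed.
  ∑-points : ∀ {d} (f : Point (suc d) → ℕ) →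
    ∑ (points (suc d)) f ≡ ∑ (points d) (λ u → ∑ elements (λ a → f (a ∷ u)))
  ∑-points {d} f = trans (∑-cartesianProductWith _∷_ elements (points d) f) (∑-swap elements (points d) _)

  ∑-elements : ∀ {ℓ} {P : Carrier → Set ℓ} (P? : Decidable P) {s} → (∀ a → P a ⇔ a ≡ s) →
    ∑ elements (λ a → ⟦ P? a ⟧) ≡ 1
  ∑-elements P? = ∑-unique _≟ᶠ_ P? elements-unique (∈-elements _)

  solution : ∀ {b} → b ≢ 0# → ∀ s → Σ Carrier λ t → ∀ a → a ⊗ b ⊕ s ≡ 0# ⇔ a ≡ t
  solution {b} b≢0 s with b⁻¹ , inverseˡ , _ ← #⇒invertible b≢0 = ⊖ s ⊗ b⁻¹ , λ a → mk⇔
      (λ eq → begin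
        a                 ≡⟨ R.*-identityʳ a ⟨
        a ⊗ 1#            ≡⟨ cong (a ⊗_) b⊗b⁻¹ ⟨
        a ⊗ (b ⊗ b⁻¹)     ≡⟨ R.*-assoc a b b⁻¹ ⟨
        a ⊗ b ⊗ b⁻¹       ≡⟨ cong (_⊗ b⁻¹) (R.+-inverseˡ-unique (a ⊗ b) s eq) ⟩
        ⊖ s ⊗ b⁻¹         ∎)
      (λ { refl → begin
        ⊖ s ⊗ b⁻¹ ⊗ b ⊕ s    ≡⟨ cong (_⊕ s) (R.*-assoc (⊖ s) b⁻¹ b) ⟩
        ⊖ s ⊗ (b⁻¹ ⊗ b) ⊕ s  ≡⟨ cong (λ z → ⊖ s ⊗ z ⊕ s) (trans (R.*-comm b⁻¹ b) b⊗b⁻¹) ⟩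
        ⊖ s ⊗ 1# ⊕ s         ≡⟨ cong (_⊕ s) (R.*-identityʳ (⊖ s)) ⟩
        ⊖ s ⊕ s              ≡⟨ R.-‿inverseˡ s ⟩
        0#                   ∎ })
    where
    open ≡-Reasoning
    -- `#⇒invertible` supplies an inverse of `b ⊕ ⊖ 0#`, which still has to be identified with `b`.
    b⊗b⁻¹ : b ⊗ b⁻¹ ≡ 1#
    b⊗b⁻¹ = trans (cong (_⊗ b⁻¹) (sym (trans (cong (b ⊕_) R.-0#≈0#) (R.+-identityʳ b))))
      (trans (R.*-comm _ b⁻¹) inverseˡ)

  -- Induction up to the first non-zero coordinate of `v`. There the matching coordinate of `u` is
  -- determined by the later ones; at a zero coordinate it is free and contributes a factor `q`.
  ∑-orthogonal : ∀ {d} (v : Point (suc d)) → v ≢ 0ᵛ → ∑ (points (suc d)) (λ u → ⟦ u · v ≟ᶠ 0# ⟧) ≡ q ^ d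
  ∑-orthogonal {d} (b ∷ v) v≢0 with b ≟ᶠ 0#
  ∑-orthogonal {d} (b ∷ v) v≢0 | no b≢0 = begin
    ∑ (points (suc d)) (λ u → ⟦ u · (b ∷ v) ≟ᶠ 0# ⟧)                        ≡⟨ ∑-points _ ⟩
    ∑ (points d) (λ u → ∑ elements (λ a → ⟦ a ⊗ b ⊕ u · v ≟ᶠ 0# ⟧))
      ≡⟨ ∑-cong (points d) (λ u → ∑-elements _ (proj₂ (solution b≢0 (u · v)))) ⟩
    ∑ (points d) (λ _ → 1)                                                  ≡⟨ ∑-const (points d) 1 ⟩
    length (points d) * 1                                                   ≡⟨ *-identityʳ _ ⟩
    length (points d)                                                       ≡⟨ length-points d ⟩
    q ^ d                                                                   ∎
    where open ≡-Reasoning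
  ∑-orthogonal {zero}  (_ ∷ []) v≢0 | yes refl = contradiction refl v≢0
  ∑-orthogonal {suc d} (_ ∷ v)  v≢0 | yes refl = begin
    ∑ (points (suc (suc d))) (λ u → ⟦ u · (0# ∷ v) ≟ᶠ 0# ⟧)
      ≡⟨ ∑-cartesianProductWith _∷_ elements (points (suc d)) _ ⟩
    ∑ elements (λ a → ∑ (points (suc d)) (λ u → ⟦ a ⊗ 0# ⊕ u · v ≟ᶠ 0# ⟧))
      ≡⟨ ∑-cong elements (λ a → ∑-cong (points (suc d)) (λ u → cong (λ z → ⟦ z ≟ᶠ 0# ⟧) (drop a u))) ⟩
    ∑ elements (λ _ → ∑ (points (suc d)) (λ u → ⟦ u · v ≟ᶠ 0# ⟧))
      ≡⟨ ∑-const elements _ ⟩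
    length elements * ∑ (points (suc d)) (λ u → ⟦ u · v ≟ᶠ 0# ⟧)
      ≡⟨ cong₂ _*_ length-elements (∑-orthogonal v (v≢0 ∘ cong (0# ∷_))) ⟩
    q ^ suc d ∎
    where
    open ≡-Reasoning
    drop : ∀ a u → a ⊗ 0# ⊕ u · v ≡ u · v
    drop a u = trans (cong (_⊕ u · v) (R.zeroʳ a)) (R.+-identityˡ _)

  -- A functional b ∷ u represents the affine form x ↦ b + u · x.
  Vanishes : ∀ {d} → Point d → Point (suc d) → Set c
  Vanishes x u = u · (1# ∷ x) ≡ 0#

  vanishes? : ∀ {d} (x : Point d) → Decidable (Vanishes x)
  vanishes? x u = u · (1# ∷ x) ≟ᶠ 0#

  -- The leading 1 makes the homogenised point non-zero, whatever `x` is.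
  ∑-vanishes : ∀ {d} (x : Point d) → ∑ (points (suc d)) (λ u → ⟦ vanishes? x u ⟧) ≡ q ^ d
  ∑-vanishes x = ∑-orthogonal (1# ∷ x) (1≢0 ∘ proj₁ ∘ ∷-injective)

  -- A form vanishing at both points has its linear part `u` orthogonal to `x -ᵛ y`. Conversely,
  -- each such `u` takes the same value at both points, and exactly one constant term cancels it.
  ∑-vanishes₂ : ∀ {d} {x y : Point (suc d)} → x ≢ y →
    ∑ (points (suc (suc d))) (λ u → ⟦ vanishes? x u ×-dec vanishes? y u ⟧) ≡ q ^ d
  ∑-vanishes₂ {d} {x} {y} x≢y = trans (∑-points _)
    (trans (∑-cong (points (suc d)) count) (∑-orthogonal (x -ᵛ y) (Line.direction≢0ᵛ (π y x x≢y))))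
    where
    difference : ∀ b u → Vanishes x (b ∷ u) → Vanishes y (b ∷ u) → u · (x -ᵛ y) ≡ 0#
    difference b u vx vy = begin
      u · (x -ᵛ y)              ≡⟨ ·--ᵛ u x y ⟩
      u · x ⊕ ⊖ (u · y)         ≡⟨ cong (_⊕ ⊖ (u · y)) (R.+-cancelˡ (b ⊗ 1#) _ _ (trans vx (sym vy))) ⟩
      u · y ⊕ ⊖ (u · y)         ≡⟨ R.-‿inverseʳ _ ⟩
      0#                        ∎
      where open ≡-Reasoning
    agree : ∀ u → u · (x -ᵛ y) ≡ 0# → u · x ≡ u · y
    agree u eq = R.x∙y⁻¹≈ε⇒x≈y _ _ (trans (sym (·--ᵛ u x y)) eq)
    count : ∀ u → ∑ elements (λ b → ⟦ vanishes? x (b ∷ u) ×-dec vanishes? y (b ∷ u) ⟧) ≡ ⟦ u · (x -ᵛ y) ≟ᶠ 0# ⟧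
    count u with u · (x -ᵛ y) ≟ᶠ 0#
    ... | no ≢0  = ∑-none (λ b → vanishes? x (b ∷ u) ×-dec vanishes? y (b ∷ u))
      (All.universal (λ b (vx , vy) → ≢0 (difference b u vx vy)) elements)
    ... | yes ≡0 with t , t-unique ← solution 1≢0 (u · x) =
      ∑-elements (λ b → vanishes? x (b ∷ u) ×-dec vanishes? y (b ∷ u)) λ b → mk⇔
        (λ (vx , _) → Equivalence.to (t-unique b) vx)
        (λ b≡t → let vx = Equivalence.from (t-unique b) b≡t in
          vx , trans (cong (b ⊗ 1# ⊕_) (sym (agree u ≡0))) vx)

  -- Homogenising respects combinations with coefficients 1 - t and t, as these add up to 1;
  -- linearity then gives the value at `p`.
  vanishes-on-line : ∀ {d} {x y : Point d} (x≢y : x ≢ y) {p u} →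
    Vanishes x u → Vanishes y u → p ∈ᴸ π y x x≢y → Vanishes p u
  vanishes-on-line {x = x} {y} _ {u = u} vx vy (t , refl) = begin
    u · (1# ∷ (y +ᵛ t *ᵛ (x -ᵛ y)))                  ≡⟨ cong (λ z → u · (z ∷ (y +ᵛ t *ᵛ (x -ᵛ y)))) one ⟩
    u · ((1# ∷ y) +ᵛ t *ᵛ ((1# ∷ x) -ᵛ (1# ∷ y)))    ≡⟨ ·-+ᵛ u _ _ ⟩
    u · (1# ∷ y) ⊕ u · (t *ᵛ ((1# ∷ x) -ᵛ (1# ∷ y)))
      ≡⟨ cong (u · (1# ∷ y) ⊕_) (trans (·-*ᵛ u t _) (cong (t ⊗_) (·--ᵛ u _ _))) ⟩
    u · (1# ∷ y) ⊕ t ⊗ (u · (1# ∷ x) ⊕ ⊖ (u · (1# ∷ y)))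
      ≡⟨ cong₂ (λ X Y → Y ⊕ t ⊗ (X ⊕ ⊖ Y)) vx vy ⟩
    0# ⊕ t ⊗ (0# ⊕ ⊖ 0#)                            ≡⟨ R.+-identityˡ _ ⟩
    t ⊗ (0# ⊕ ⊖ 0#)                                 ≡⟨ trans (cong (t ⊗_) (R.-‿inverseʳ 0#)) (R.zeroʳ t) ⟩
    0#                                              ∎
    where
    open ≡-Reasoning
    one : 1# ≡ 1# ⊕ t ⊗ (1# ⊕ ⊖ 1#)
    one = sym (trans (cong (1# ⊕_) (trans (cong (t ⊗_) (R.-‿inverseʳ 1#)) (R.zeroʳ t))) (R.+-identityʳ 1#))

  -- The 2-design of common zero sets, and its link to radial projections.

  module Blocks (d k : ℕ) where

    Block : Set c
    Block = Vec (Point (suc (suc d))) k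

    blocks : List Block
    blocks = tuples (points (suc (suc d))) k

    _∈ᴮ_ : Point (suc d) → Block → Set c
    x ∈ᴮ β = Vec.All (Vanishes x) β

    _∈ᴮ?_ : ∀ x β → Dec (x ∈ᴮ β)
    x ∈ᴮ? β = Vec.all? (vanishes? x) β

    private
      -- Two distinct points leave `q ^ d` forms for each of the `k` entries, whence `K`. Dropping
      -- one vanishing condition multiplies the choices per entry by `q`, hence the number of tuples
      -- by `Q`.
      K Q : ℕ
      K = (q ^ d) ^ k
      Q = q ^ k

      instance
        K≢0 : NonZero K
        K≢0 = m^n≢0 (q ^ d) k {{m^n≢0 q d}}
        Q≢0 : NonZero Q
        Q≢0 = m^n≢0 q k

      power : ∀ n → (q ^ suc n) ^ k ≡ (q ^ n) ^ k * Q
      power n = begin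
        (q ^ suc n) ^ k          ≡⟨ ^-*-assoc q (suc n) k ⟩
        q ^ (k + n * k)          ≡⟨ ^-distribˡ-+-* q k (n * k) ⟩
        Q * q ^ (n * k)          ≡⟨ cong (_*_ Q) (^-*-assoc q n k) ⟨
        Q * (q ^ n) ^ k          ≡⟨ *-comm Q _ ⟩
        (q ^ n) ^ k * Q          ∎
        where open ≡-Reasoning

      ∣blocks∣ : length blocks ≡ K * Q * Q
      ∣blocks∣ = begin
        length blocks                              ≡⟨ length-tuples (points (suc (suc d))) k ⟩
        length (points (suc (suc d))) ^ k          ≡⟨ cong (_^ k) (length-points (suc (suc d))) ⟩
        (q ^ suc (suc d)) ^ k                      ≡⟨ power (suc d) ⟩
        (q ^ suc d) ^ k * Q                        ≡⟨ cong (_* Q) (power d) ⟩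
        K * Q * Q                                  ∎
        where open ≡-Reasoning

      degree : ∀ x → ∑ blocks (λ β → ⟦ x ∈ᴮ? β ⟧) ≡ K * Q
      degree x = trans (∑-tuples (vanishes? x) (points (suc (suc d))) k)
        (trans (cong (_^ k) (∑-vanishes x)) (power d))

      codegree : ∀ {x y} → x ≢ y → ∑ blocks (λ β → ⟦ x ∈ᴮ? β ×-dec y ∈ᴮ? β ⟧) ≡ K
      codegree {x} {y} x≢y = begin
        ∑ blocks (λ β → ⟦ x ∈ᴮ? β ×-dec y ∈ᴮ? β ⟧)
          ≡⟨ ∑-cong blocks (λ β → ⟦⟧-cong (mk⇔ Vec.zip Vec.unzip) (x ∈ᴮ? β ×-dec y ∈ᴮ? β) (Vec.all? both? β)) ⟩
        ∑ blocks (λ β → ⟦ Vec.all? both? β ⟧)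
          ≡⟨ ∑-tuples both? (points (suc (suc d))) k ⟩
        ∑ (points (suc (suc d))) (λ u → ⟦ both? u ⟧) ^ k
          ≡⟨ cong (_^ k) (∑-vanishes₂ x≢y) ⟩
        K ∎
        where
        open ≡-Reasoning
        both? : Decidable (λ u → Vanishes x u × Vanishes y u)
        both? u = vanishes? x u ×-dec vanishes? y u

    open Design _≟ᵛ_ {_∈ᴮ_ = _∈ᴮ_} _∈ᴮ?_ blocks K Q ∣blocks∣ degree codegree

    module _ {ℓ} {E : Pred (Point (suc d)) ℓ} (E? : Decidable E) where

      private
        Eˡ : List (Point (suc d))
        Eˡ = filter E? (points (suc d))

      -- Deduplication may discard the very line produced by `project`, but it keeps one with the
      -- same points, and containing `x` and `y` depends on the points alone.
      radialLine-through : ∀ {x y} → x ∈ Eˡ → x ≢ y →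
        Any (λ l → y ∈ᴸ l × x ∈ᴸ l) (deduplicate _≈ᴸ?_ (radialLines y E?))
      radialLine-through {x} {y} x∈E x≢y = Any.deduplicate⁺ _≈ᴸ?_
        (λ m≈l (y∈l , x∈l) → Equivalence.from (m≈l y) y∈l , Equivalence.from (m≈l x) x∈l)
        (Any.mapMaybe⁺ (project y) Eˡ (Any.map⁺ (Any.map (λ { refl → through }) x∈E)))
        where
        through : Maybe.Any (λ l → y ∈ᴸ l × x ∈ᴸ l) (project y x)
        through with x ≟ᵛ y
        ... | yes x≡y = contradiction x≡y x≢y
        ... | no x≢y′ = Maybe.just (y∈π y x x≢y′ , x∈π y x x≢y′)

      -- A union bound: each secant block at `y` contains one of the listed lines, and every line
      -- lies in `K` blocks.
      ∑-secant : ∀ y → ∑ blocks (λ β → ⟦ secant? Eˡ y β ⟧) ≤ cardRadial y E? * K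
      ∑-secant y = begin
        ∑ blocks (λ β → ⟦ secant? Eˡ y β ⟧)                         ≤⟨ ∑-mono blocks (λ {β} _ → cover β) ⟩
        ∑ blocks (λ β → ∑ lines (λ l → ⟦ contains? l β ⟧))          ≡⟨ ∑-swap blocks lines _ ⟩
        ∑ lines (λ l → ∑ blocks (λ β → ⟦ contains? l β ⟧))          ≡⟨ ∑-cong lines (λ l → codegree (distinct l)) ⟩
        ∑ lines (λ _ → K)                                           ≡⟨ ∑-const lines K ⟩
        cardRadial y E? * K                                         ∎
        where
        open ≤-Reasoning
        lines : List (Line (suc d))
        lines = deduplicate _≈ᴸ?_ (radialLines y E?)
        at : Carrier → Line (suc d) → Point (suc d)
        at t l = Line.base l +ᵛ t *ᵛ Line.direction l
        -- Containment of a line is tested at two distinct points of it, so that the codegree counts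
        -- the blocks.
        contains? : ∀ l β → Dec (at 0# l ∈ᴮ β × at 1# l ∈ᴮ β)
        contains? l β = at 0# l ∈ᴮ? β ×-dec at 1# l ∈ᴮ? β
        distinct : ∀ l → at 0# l ≢ at 1# l
        distinct (line b v v≢0) eq = v≢0 (zero-direction b v eq)
          where
          zero-direction : ∀ {n} (b v : Point n) → b +ᵛ 0# *ᵛ v ≡ b +ᵛ 1# *ᵛ v → v ≡ 0ᵛ
          zero-direction []      []      _  = refl
          zero-direction (b ∷ bs) (a ∷ v) eq with eq₁ , eq₂ ← ∷-injective eq = cong₂ _∷_
            (trans (sym (R.*-identityˡ a)) (trans (sym (R.+-cancelˡ b _ _ eq₁)) (R.zeroˡ a)))
            (zero-direction bs v eq₂)
        cover : ∀ β → ⟦ secant? Eˡ y β ⟧ ≤ ∑ lines (λ l → ⟦ contains? l β ⟧)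
        cover β with secant? Eˡ y β
        ... | no _ = z≤n
        ... | yes (y∈β , secant) with x , x∈E , x≢y , x∈β ← find secant
          with l , l∈ , y∈l , x∈l ← find (radialLine-through x∈E x≢y) =
          ≤-trans (≤-reflexive (sym (⟦⟧-true (contains? l β) (on 0# , on 1#)))) (≤-∑ (λ l → ⟦ contains? l β ⟧) l∈)
          where
          -- By uniqueness of the line through `x` and `y`, the points of `l` lie on `π y x`, along
          -- which all forms of `β` vanish.
          on : ∀ t → at t l ∈ᴮ β
          on t = Vec.map (λ {u} (vx , vy) → vanishes-on-line x≢y {u = u} vx vy
            (Equivalence.to (π-unique y x x≢y l y∈l x∈l _) (t , refl))) (Vec.zip (x∈β , y∈β))

      few-radialLines-bound : ∀ {Y : List (Point (suc d))} .{{_ : NonZero (length Y)}} → Unique Y →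
        ∀ m → (∀ {y} → y ∈ Y → cardRadial y E? ≤ m) →
        Q * (length Y * card E?) ≤ 2 * (length Y * Q) + Q * Q * (length Y + m) + 2 * (length Y * card E? * m)
      few-radialLines-bound Y-unique m Y≤m = few-secants-bound
        (Unique.filter⁺ E? (points-unique (suc d))) Y-unique m
        (λ {y} y∈Y → ≤-trans (∑-secant y) (*-monoˡ-≤ K (Y≤m y∈Y)))

-- Numerical conclusion.

few-radialLines-arithmetic : ∀ {Q Y e m} .{{_ : NonZero Q}} → 30 * Q ≤ e → 4 * m ≤ Q → 0 < m →
  Q * (Y * e) ≤ 2 * (Y * Q) + Q * Q * (Y + m) + 2 * (Y * e * m) →
  Y * e < 300 * Q * m
few-radialLines-arithmetic {Q} {Y} {e} {m} 30Q≤e 4m≤Q 0<m bound = begin-strict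
  Y * e             ≤⟨ m≤m+n _ (23 * (Y * e)) ⟩
  24 * (Y * e)      ≤⟨ +-cancelˡ-≤ (6 * (Y * e)) _ _ absorbed ⟩
  -- The estimate leaves ample room below 300; strictness needs only that `Q * m` is non-zero.
  60 * (Q * m)      <⟨ *-monoˡ-< (Q * m) {{m*n≢0 Q m}} {60} {300} (from-yes (60 <? 300)) ⟩
  300 * (Q * m)     ≡⟨ *-assoc 300 Q m ⟨
  300 * Q * m       ∎
  where
  open ≤-Reasoning
  instance
    m≢0 : NonZero m
    m≢0 = >-nonZero 0<m
  30≤e : 30 ≤ e
  30≤e = ≤-trans (m≤m*n 30 Q) 30Q≤e
  -- After doubling, `4 * m ≤ Q` lets the term 4Yem be absorbed by one of the two copies of QYe, and
  -- a factor `Q` is cancelled from what remains.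
  divided : Y * e ≤ 4 * Y + 2 * Q * (Y + m)
  divided = *-cancelˡ-≤ Q (+-cancelˡ-≤ (Q * (Y * e)) _ _ (begin
    Q * (Y * e) + Q * (Y * e)                                          ≡⟨ double (Q * (Y * e)) ⟩
    2 * (Q * (Y * e))                                                  ≤⟨ *-monoʳ-≤ 2 bound ⟩
    2 * (2 * (Y * Q) + Q * Q * (Y + m) + 2 * (Y * e * m))              ≡⟨ regroup Q Y e m ⟩
    Y * e * (4 * m) + Q * (4 * Y + 2 * Q * (Y + m))                    ≤⟨ +-monoˡ-≤ _ (*-monoʳ-≤ (Y * e) 4m≤Q) ⟩
    Y * e * Q + Q * (4 * Y + 2 * Q * (Y + m))                          ≡⟨ cong (_+ Q * (4 * Y + 2 * Q * (Y + m))) (*-comm (Y * e) Q) ⟩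
    Q * (Y * e) + Q * (4 * Y + 2 * Q * (Y + m))                        ∎))
    where
    double : ∀ x → x + x ≡ 2 * x
    double = solve-∀
    regroup : ∀ Q Y e m → 2 * (2 * (Y * Q) + Q * Q * (Y + m) + 2 * (Y * e * m)) ≡
      Y * e * (4 * m) + Q * (4 * Y + 2 * Q * (Y + m))
    regroup = solve-∀
  -- Of the 30 copies of Ye, the terms 4Y and 2QY take at most 4 and 2, by `30≤e` and `30Q≤e`.
  absorbed : 6 * (Y * e) + 24 * (Y * e) ≤ 6 * (Y * e) + 60 * (Q * m)
  absorbed = begin
    6 * (Y * e) + 24 * (Y * e)                              ≡⟨ total (Y * e) ⟩
    30 * (Y * e)                                            ≤⟨ *-monoʳ-≤ 30 divided ⟩
    30 * (4 * Y + 2 * Q * (Y + m))                          ≡⟨ spread Q Y m ⟩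
    4 * (Y * 30) + 2 * (Y * (30 * Q)) + 60 * (Q * m)
      ≤⟨ +-monoˡ-≤ _ (+-mono-≤ (*-monoʳ-≤ 4 (*-monoʳ-≤ Y 30≤e)) (*-monoʳ-≤ 2 (*-monoʳ-≤ Y 30Q≤e))) ⟩
    4 * (Y * e) + 2 * (Y * e) + 60 * (Q * m)                ≡⟨ cong (_+ 60 * (Q * m)) (six (Y * e)) ⟩
    6 * (Y * e) + 60 * (Q * m)                              ∎
    where
    total : ∀ x → 6 * x + 24 * x ≡ 30 * x
    total = solve-∀
    six : ∀ x → 4 * x + 2 * x ≡ 6 * x
    six = solve-∀
    spread : ∀ Q Y m → 30 * (4 * Y + 2 * Q * (Y + m)) ≡ 4 * (Y * 30) + 2 * (Y * (30 * Q)) + 60 * (Q * m)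
    spread = solve-∀

theorem1p2 : ∀ {c ℓ : Level} (q : ℕ) → IsPrimePower q → (F : FiniteField c q) → let open Affine F in
    (d k : ℕ) → 1 ≤ d → 1 ≤ k → k < d →
    (E : Pred (Point d) ℓ) (E? : Decidable E) →
    30 * q ^ k ≤ card E? → card E? ≤ q ^ suc k →
    (M : ℤ) → + card E? ≤ℤ M *ℤ + q → + 4 *ℤ M ≤ℤ + (q ^ k) →
    + card (λ y → + cardRadial y E? ≤? M) *ℤ + card E? <ℤ + 300 *ℤ + (q ^ k) *ℤ M
theorem1p2 q _ F (suc d) k _ _ _ E E? 30Q≤e _ M e≤Mq 4M≤Q = main M e≤Mq 4M≤Q
  where
  open Affine F
  open Hyperplanes F
  instance
    Q≢0 : NonZero (q ^ k)
    Q≢0 = m^n≢0 q k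
  0<e : 0 < card E?
  0<e = ≤-trans (≤-trans (s≤s z≤n) (m≤m*n 30 (q ^ k))) 30Q≤e
  main : ∀ M → + card E? ≤ℤ M *ℤ + q → + 4 *ℤ M ≤ℤ + (q ^ k) →
    + card (λ y → + cardRadial y E? ≤? M) *ℤ + card E? <ℤ + 300 *ℤ + (q ^ k) *ℤ M
  -- A negative M would make |E| at most Mq ≤ 0, although E is non-empty.
  main (-[1+ n ]) e≤Mq _ = contradiction
    (ℤ.<-≤-trans (+<+ 0<e) (ℤ.≤-trans e≤Mq (ℤ.*-monoʳ-≤-nonNeg (+ q) { -[1+ n ]} {+ 0} -≤+))) (ℤ.<-irrefl refl)
  main (+ m) e≤mq 4m≤Q = subst₂ _<ℤ_ (ℤ.pos-* ∣Y∣ (card E?))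
    (trans (ℤ.pos-* (300 * q ^ k) m) (cong (_*ℤ + m) (ℤ.pos-* 300 (q ^ k)))) (+<+ Y*e<)
    where
    few? : Decidable (λ y → + cardRadial y E? ≤ℤ + m)
    few? y = + cardRadial y E? ≤? + m
    ∣Y∣ : ℕ
    ∣Y∣ = card few?
    0<m : 0 < m
    0<m = n≢0⇒n>0 λ { refl → <⇒≱ 0<e (ℤ.drop‿+≤+ e≤mq) }
    instance
      m≢0 : NonZero m
      m≢0 = >-nonZero 0<m
    Y*e< : ∣Y∣ * card E? < 300 * q ^ k * m
    Y*e< with ∣Y∣ ≟ 0
    -- The moment argument cancels a factor `∣Y∣`, so an empty exceptional set is treated apart; the
    -- right side is then positive because `m` is.
    ... | yes ∣Y∣≡0 = subst (λ z → z * card E? < 300 * q ^ k * m) (sym ∣Y∣≡0)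
      (>-nonZero⁻¹ _ {{m*n≢0 (300 * q ^ k) m {{m*n≢0 300 (q ^ k)}}}})
    ... | no ∣Y∣≢0 = few-radialLines-arithmetic {q ^ k} {∣Y∣} {card E?} {m} 30Q≤e (ℤ.drop‿+≤+ (subst (_≤ℤ _) (sym (ℤ.pos-* 4 m)) 4m≤Q)) 0<m
      (Blocks.few-radialLines-bound d k E? {{≢-nonZero ∣Y∣≢0}}
        (Unique.filter⁺ few? (points-unique (suc d))) m
        (λ y∈Y → ℤ.drop‿+≤+ (proj₂ (∈-filter⁻ few? {xs = points (suc d)} y∈Y))))
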